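{- Every graph $G$ of stability at most two is b-continuous; that is, $G$ admits a b-coloring with exactly $t$ colors for every integer $t$ with $\chi(G) \le t \le \chi_b(G)$.
   Context: Graphs are finite and simple. The stability of a graph is the maximum cardinality of a set of pairwise non-adjacent vertices. A b-coloring of $G$ with $t$ colors is a proper coloring of the vertices with $t$ colors such that every color class contains a vertex that is adjacent to all other $t-1$ color classes. $\chi(G)$ is the chromatic number of $G$, and the b-chromatic number $\chi_b(G)$ is the maximum $t$ such that $G$ admits a b-coloring with $t$ colors. -}

module Defs where

open import Data.Fin using (Fin)
open import Data.Fin.Subset using (Subset; _∈_; ∣_∣)
open import Data.Nat using (ℕ; _≤_)
open import Data.Product using (_×_; ∃-syntax)
open import Level using (0ℓ)
open import Relation.Binary.Core using (Rel)
open import Relation.Binary.Definitions using (Decidable; Irreflexive; Symmetric)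
open import Relation.Binary.PropositionalEquality using (_≡_; _≢_)
open import Relation.Nullary using (¬_)
open import Relation.Unary using (Pred)

-- Adjacency is required to be decidable, as it always is for a finite graph
-- read classically.
record Graph (n : ℕ) : Set₁ where
  field
    Adj    : Rel (Fin n) 0ℓ
    adj?   : Decidable Adj
    irrefl : Irreflexive _≡_ Adj
    symm   : Symmetric Adj

open Graph public

IsMaximum : Pred ℕ 0ℓ → ℕ → Set
IsMaximum P m = P m × (∀ k → P k → k ≤ m)

IsMinimum : Pred ℕ 0ℓ → ℕ → Set
IsMinimum P m = P m × (∀ k → P k → m ≤ k)

module _ {n : ℕ} (G : Graph n) where

  -- The case u = v is harmless because Adj is irreflexive.
  IsStable : Subset n → Set
  IsStable S = ∀ {u v} → u ∈ S → v ∈ S → ¬ Adj G u v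

  IsStability : ℕ → Set
  IsStability = IsMaximum (λ k → ∃[ S ] IsStable S × ∣ S ∣ ≡ k)

  IsProper : {t : ℕ} → (Fin n → Fin t) → Set
  IsProper c = ∀ {u v} → Adj G u v → c u ≢ c v

  IsBVertex : {t : ℕ} → (Fin n → Fin t) → Fin n → Set
  IsBVertex c v = ∀ j → j ≢ c v → ∃[ w ] Adj G v w × c w ≡ j

  IsBColoring : {t : ℕ} → (Fin n → Fin t) → Set
  IsBColoring c = IsProper c × (∀ i → ∃[ v ] c v ≡ i × IsBVertex c v)

  -- Some colors may be unused here; this does not affect the minimum.  In a
  -- b-coloring every color is used, since every class contains a b-vertex.
  Colorable : ℕ → Set
  Colorable t = ∃[ c ] IsProper {t} c

  BColorable : ℕ → Set
  BColorable t = ∃[ c ] IsBColoring {t} c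

  IsChromaticNumber : ℕ → Set
  IsChromaticNumber = IsMinimum Colorable

  IsBChromaticNumber : ℕ → Set
  IsBChromaticNumber = IsMaximum BColorable

  BContinuous : Set
  BContinuous = ∀ χ χb → IsChromaticNumber χ → IsBChromaticNumber χb →
                ∀ t → χ ≤ t → t ≤ χb → BColorable t

-- Since the complement H of G is triangle-free, the colorings of G are the
-- matchings of H, and the b-colorings are the matchings with no augmenting path
-- of length at most three.  Let M be such a matching that is not maximum
-- in size, and among the matchings with |M| + 1 edges let N be one
-- closest to M.  If N had an augmenting path of length at most three, giving N′,
-- then the symmetric difference of M and N′ would split into two unions of
-- components, each of which enlarges M by one edge.  The smaller part is closer
-- to M than N unless M and N differ on at most four vertices, and that would
-- give a short augmenting path for M.

module Submission where

open import Defs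
open import Data.Nat using (ℕ; _≤_)

open import Data.Bool using (Bool; true; false; not; _∧_; _∨_; if_then_else_)
open import Data.Bool.Properties using (∧-zeroʳ; ∧-identityʳ; ¬-not)
open import Data.Empty using (⊥; ⊥-elim)
open import Data.Fin using (Fin; zero; suc; toℕ; inject≤)
open import Data.Fin.Permutation using (Permutation; permutation)
open import Data.Fin.Properties using (_≟_; any?; suc-injective; inject≤-injective; toℕ-injective)
open import Data.Fin.Subset using (Subset; ⁅_⁆; _∪_; _∈_; ∣_∣; _⊂_)
open import Data.Fin.Subset.Properties
  using (x∈⁅x⁆; x∈⁅y⁆⇒x≡y; ∣⁅x⁆∣≡1; x∈p∪q⁻; p⊆p∪q; q⊆p∪q; p⊂q⇒∣p∣<∣q∣)
open import Data.List using ([]; _∷_; length)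
open import Data.List.Relation.Unary.All as All using (All; []; _∷_)
open import Data.List.Relation.Unary.AllPairs using ([]; _∷_)
open import Data.List.Relation.Unary.Unique.Propositional using (Unique)
open import Data.Nat using (zero; suc; _+_; _<_; _≤?_; z≤n; s≤s)
open import Data.Nat.Properties as ℕₚ using (module ≤-Reasoning; +-0-commutativeMonoid)
open import Data.Nat.Tactic.RingSolver using (solve-∀)
open import Data.Product using (∃-syntax; Σ-syntax; _×_; _,_; proj₁; proj₂)
open import Data.Sum using (_⊎_; inj₁; inj₂; [_,_]′)
open import Function using (_∘_; id)
open import Function.Definitions using (Injective)
open import Relation.Binary.Definitions using (tri<; tri≈; tri>)
open import Relation.Binary.PropositionalEquality
  using (_≡_; _≢_; _≗_; refl; sym; trans; cong; cong₂; subst; module ≡-Reasoning)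
open import Relation.Nullary using (¬_; Dec; yes; no; does)
open import Relation.Nullary.Decidable using (dec-true; dec-false; decidable-stable; ¬?; _×-dec_)

open import Algebra.Properties.CommutativeMonoid.Sum +-0-commutativeMonoid
  using (sum; sum-cong-≗; ∑-distrib-+; ∑-comm; sum-permute)

-- A coloring whose classes have at most two vertices has `(n + unmatched) / 2` classes, so one
-- color fewer means two unmatched vertices fewer. All counting is therefore done on unmatched
-- vertices, encoded as fixed points of an involution. The obstacle is that enlarging a stuck
-- matching by one edge can create new short augmenting paths, and augmenting along one of them adds
-- a second edge and skips the desired size. Returning to `M` on a part of the symmetric difference
-- undoes one of the two edges. The distance of two matchings is the number of vertices whose mates
-- differ. It is additive over the two parts, and a short augmentation raises it by at most 4,
-- whereas a stuck `M` has distance at least 5 from every matching with one more edge. Minimality of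
-- `N` is replaced by recursion on the distance. The bound `χ ≤ t` provides, at every number of
-- colors above `t`, a matching larger than the current one.

private
  variable
    n : ℕ

-- Counting

does⇒ : ∀ {A : Set} (a? : Dec A) → does a? ≡ true → A
does⇒ (yes a) _ = a

does⇒¬ : ∀ {A : Set} (a? : Dec A) → does a? ≡ false → ¬ A
does⇒¬ (no ¬a) _ = ¬a

true≢false : ∀ {b} → b ≡ true → b ≡ false → ⊥
true≢false refl ()

sum-mono-≤ : ∀ {f g : Fin n → ℕ} → (∀ v → f v ≤ g v) → sum f ≤ sum g
sum-mono-≤ {zero}  f≤g = z≤n
sum-mono-≤ {suc n} f≤g = ℕₚ.+-mono-≤ (f≤g zero) (sum-mono-≤ (f≤g ∘ suc))

𝟙 : Bool → ℕ
𝟙 b = if b then 1 else 0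

infix 4 _==_

_==_ : Fin n → Fin n → Bool
u == v = does (u ≟ v)

count : (Fin n → Bool) → ℕ
count p = sum (𝟙 ∘ p)

_∩_ : (Fin n → Bool) → (Fin n → Bool) → Fin n → Bool
(p ∩ q) v = p v ∧ q v

∁ : (Fin n → Bool) → Fin n → Bool
∁ p v = not (p v)

insert : Fin n → (Fin n → Bool) → Fin n → Bool
insert x p v = (v == x) ∨ p v

remove : Fin n → (Fin n → Bool) → Fin n → Bool
remove x p v = not (v == x) ∧ p v

count-cong : ∀ {p q : Fin n → Bool} → p ≗ q → count p ≡ count q
count-cong p≗q = sum-cong-≗ (cong 𝟙 ∘ p≗q)

count-none : ∀ (p : Fin n → Bool) → (∀ v → p v ≡ false) → count p ≡ 0
count-none {zero}  p _    = refl
count-none {suc n} p none rewrite none zero = count-none (p ∘ suc) (none ∘ suc)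

count-all : ∀ n → count {n} (λ _ → true) ≡ n
count-all zero    = refl
count-all (suc n) = cong suc (count-all n)

count-== : ∀ (x : Fin n) → count (_== x) ≡ 1
count-== {suc n} zero    = cong suc (count-none {n} (λ v → suc v == zero) (λ _ → refl))
count-== {suc n} (suc x) = count-== x

count-∃ : ∀ (p : Fin n → Bool) → 1 ≤ count p → ∃[ v ] p v ≡ true
count-∃ {suc n} p 1≤ with p zero in eq
... | true  = zero , eq
... | false with count-∃ (p ∘ suc) 1≤
...   | v , pv = suc v , pv

count-remove : ∀ (p : Fin n → Bool) {x} → p x ≡ true → count p ≡ suc (count (remove x p))
count-remove p {x} px = begin
  count p                                           ≡⟨ sum-cong-≗ pointwise ⟩
  sum (λ v → 𝟙 (v == x) + 𝟙 (remove x p v))         ≡⟨ ∑-distrib-+ (λ v → 𝟙 (v == x)) _ ⟩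
  count (_== x) + count (remove x p)                ≡⟨ cong (_+ count (remove x p)) (count-== x) ⟩
  suc (count (remove x p))                          ∎
  where
  open ≡-Reasoning
  pointwise : ∀ v → 𝟙 (p v) ≡ 𝟙 (v == x) + 𝟙 (remove x p v)
  pointwise v with v ≟ x
  ... | yes refl = cong 𝟙 px
  ... | no _     = refl

count-insert : ∀ (p q : Fin n → Bool) {x} → p x ≡ false →
               count (insert x p ∩ q) ≡ 𝟙 (q x) + count (p ∩ q)
count-insert p q {x} px with q x in qx
... | false = sum-cong-≗ pointwise
  where
  pointwise : ∀ v → 𝟙 ((insert x p ∩ q) v) ≡ 𝟙 ((p ∩ q) v)
  pointwise v with v ≟ x
  ... | yes refl rewrite qx | px = refl
  ... | no _     = refl
... | true = begin
  count (insert x p ∩ q)                    ≡⟨ sum-cong-≗ pointwise ⟩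
  sum (λ v → 𝟙 (v == x) + 𝟙 ((p ∩ q) v))    ≡⟨ ∑-distrib-+ (λ v → 𝟙 (v == x)) _ ⟩
  count (_== x) + count (p ∩ q)             ≡⟨ cong (_+ count (p ∩ q)) (count-== x) ⟩
  suc (count (p ∩ q))                       ∎
  where
  open ≡-Reasoning
  pointwise : ∀ v → 𝟙 ((insert x p ∩ q) v) ≡ 𝟙 (v == x) + 𝟙 ((p ∩ q) v)
  pointwise v with v ≟ x
  ... | yes refl rewrite qx | px = refl
  ... | no _     = refl

count-∁-insert : ∀ (p : Fin n → Bool) {x} → p x ≡ false →
                 count (∁ p) ≡ suc (count (∁ (insert x p)))
count-∁-insert p {x} px =
  trans (count-remove (∁ p) {x} (cong not px)) (cong suc (count-cong pointwise))
  where
  pointwise : remove x (∁ p) ≗ ∁ (insert x p)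
  pointwise v with v ≟ x
  ... | yes _ = refl
  ... | no _  = refl

count-split : ∀ (p q : Fin n → Bool) → count q ≡ count (p ∩ q) + count (∁ p ∩ q)
count-split p q = trans (sum-cong-≗ pointwise) (∑-distrib-+ (𝟙 ∘ (p ∩ q)) _)
  where
  pointwise : ∀ v → 𝟙 (q v) ≡ 𝟙 ((p ∩ q) v) + 𝟙 ((∁ p ∩ q) v)
  pointwise v with p v
  ... | true  = sym (ℕₚ.+-identityʳ _)
  ... | false = refl

unique⇒length≤count : ∀ (p : Fin n → Bool) {xs} → Unique xs → All (λ v → p v ≡ true) xs →
                      length xs ≤ count p
unique⇒length≤count p []         []         = z≤n
unique⇒length≤count p {x ∷ xs} (x∉ ∷ uxs) (px ∷ pxs) rewrite count-remove p px =
  s≤s (unique⇒length≤count (remove x p) uxs (All.zipWith keep (x∉ , pxs)))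
  where
  keep : ∀ {v} → x ≢ v × p v ≡ true → remove x p v ≡ true
  keep {v} (x≢v , pv) rewrite dec-false (v ≟ x) (x≢v ∘ sym) = pv

count-unique : ∀ (p : Fin n → Bool) → (∀ {u v} → p u ≡ true → p v ≡ true → u ≡ v) →
               count p ≤ 1
count-unique p unique with any? (λ v → p v Data.Bool.≟ true)
... | no none = ℕₚ.≤-trans (ℕₚ.≤-reflexive (count-none p λ v → ¬-not λ pv → none (v , pv))) z≤n
... | yes (x , px) = ℕₚ.≤-reflexive (trans (count-cong pointwise) (count-== x))
  where
  pointwise : p ≗ (_== x)
  pointwise v with v ≟ x
  ... | yes refl = px
  ... | no v≢x   = ¬-not λ pv → v≢x (unique pv px)

enumerate : ∀ (p : Fin n → Bool) → Σ[ e ∈ (Fin (count p) → Fin n) ]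
            (∀ i → p (e i) ≡ true) × (∀ v → p v ≡ true → ∃[ i ] e i ≡ v) × Injective _≡_ _≡_ e
enumerate {zero}  p = (λ ()) , (λ ()) , (λ ()) , λ { {()} }
enumerate {suc n} p with p zero in eq | enumerate (p ∘ suc)
... | false | e , e-in , e-onto , e-inj = suc ∘ e , e-in , onto , e-inj ∘ suc-injective
  where
  onto : ∀ v → p v ≡ true → ∃[ i ] suc (e i) ≡ v
  onto zero    pv = ⊥-elim (true≢false pv eq)
  onto (suc v) pv with e-onto v pv
  ... | i , refl = i , refl
... | true | e , e-in , e-onto , e-inj = e′ , in′ , onto , inj
  where
  e′ : Fin (suc (count (p ∘ suc))) → Fin (suc n)
  e′ zero    = zero
  e′ (suc i) = suc (e i)
  in′ : ∀ i → p (e′ i) ≡ true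
  in′ zero    = eq
  in′ (suc i) = e-in i
  onto : ∀ v → p v ≡ true → ∃[ i ] e′ i ≡ v
  onto zero    pv = zero , refl
  onto (suc v) pv with e-onto v pv
  ... | i , refl = suc i , refl
  inj : Injective _≡_ _≡_ e′
  inj {zero}  {zero}  _  = refl
  inj {suc i} {suc j} eq = cong suc (e-inj (suc-injective eq))

insert-here : ∀ x (p : Fin n → Bool) → insert x p x ≡ true
insert-here x p rewrite dec-true (x ≟ x) refl = refl

insert-there : ∀ x (p : Fin n → Bool) v → p v ≡ true → insert x p v ≡ true
insert-there x p v pv with v ≟ x
... | yes _ = refl
... | no _  = pv

insert⁻ : ∀ x (p : Fin n → Bool) v → insert x p v ≡ true → v ≡ x ⊎ p v ≡ true
insert⁻ x p v v∈ with v ≟ x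
... | yes v≡x = inj₁ v≡x
... | no _    = inj₂ v∈

∉-insert : ∀ {x v} (p : Fin n → Bool) → v ≢ x → p v ≡ false → insert x p v ≡ false
∉-insert {x = x} {v} p v≢x pv rewrite dec-false (v ≟ x) v≢x = pv

∉-insert⁻ : ∀ x (p : Fin n → Bool) v → insert x p v ≡ false → v ≢ x × p v ≡ false
∉-insert⁻ x p v v∉ with v ≟ x
... | no v≢x = v≢x , v∉

∅ : Fin n → Bool
∅ _ = false

count-insert-≤ : ∀ (p : Fin n → Bool) x → count (insert x p) ≤ suc (count p)
count-insert-≤ p x = begin
  count (insert x p)                   ≤⟨ sum-mono-≤ pointwise ⟩
  sum (λ v → 𝟙 (v == x) + 𝟙 (p v))     ≡⟨ ∑-distrib-+ (λ v → 𝟙 (v == x)) _ ⟩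
  count (_== x) + count p              ≡⟨ cong (_+ count p) (count-== x) ⟩
  suc (count p)                        ∎
  where
  open ≤-Reasoning
  pointwise : ∀ v → 𝟙 (insert x p v) ≤ 𝟙 (v == x) + 𝟙 (p v)
  pointwise v with v ≟ x
  ... | yes _ = s≤s z≤n
  ... | no _  = ℕₚ.≤-refl

-- Fixed points of involutions

Involutive : (Fin n → Fin n) → Set
Involutive f = ∀ v → f (f v) ≡ v

Closed : (Fin n → Fin n) → (Fin n → Bool) → Set
Closed f C = ∀ v → C v ≡ true → C (f v) ≡ true

fixed : (Fin n → Fin n) → Fin n → Bool
fixed f v = f v == v

closed⁻ : ∀ {f : Fin n → Fin n} {C} → Involutive f → Closed f C → ∀ v → C v ≡ false → C (f v) ≡ false
closed⁻ {f = f} {C} f-inv closed v v∉ =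
  ¬-not λ fv∈ → true≢false (subst (λ u → C u ≡ true) (f-inv v) (closed (f v) fv∈)) v∉

closed-∁ : ∀ {f : Fin n → Fin n} {C} → Involutive f → Closed f C → Closed f (∁ C)
closed-∁ {C = C} f-inv closed v v∈ with C v in eq
... | false = cong not (closed⁻ f-inv closed v eq)

module _ {f g : Fin n → Fin n} (f-inv : Involutive f) (g-inv : Involutive g) where

  -- A union of components of the alternating graph of f and g, followed by an
  -- initial piece of a path component which starts at a fixed point of f and
  -- currently ends in x.
  record Walk (C : Fin n → Bool) (x : Fin n) : Set where
    field
      x∉C      : C x ≡ false
      g-closed : Closed g C
      f-closed : Closed f (insert x C)
      balance  : count (insert x C ∩ fixed f) ≡ suc (count (C ∩ fixed g))

  -- Two more fixed points of `f` than of `g` on a common closed set amount to one edge gained when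
  -- `f` is exchanged for `g` there.
  Surplus : Set
  Surplus = ∃[ C ] Closed f C × Closed g C × count (C ∩ fixed f) ≡ 2 + count (C ∩ fixed g)

  module _ (g<f : count (fixed g) < count (fixed f)) where

    -- Outside a balanced closed set the fixed points of `f` still outnumber those of `g`, so a new
    -- path component can be entered at a fixed point of `f`.
    start : ∀ {C} → Closed f C → Closed g C → count (C ∩ fixed f) ≡ count (C ∩ fixed g) →
            ∃[ x ] Walk C x
    start {C} f-closed g-closed balance with count-∃ (∁ C ∩ fixed f) positive
      where
      open ≤-Reasoning
      positive : 1 ≤ count (∁ C ∩ fixed f)
      positive = ℕₚ.+-cancelˡ-≤ (count (C ∩ fixed g)) 1 _ (begin
        count (C ∩ fixed g) + 1                           ≤⟨ ℕₚ.+-monoˡ-≤ 1 (ℕₚ.m≤m+n _ _) ⟩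
        count (C ∩ fixed g) + count (∁ C ∩ fixed g) + 1   ≡⟨ cong (_+ 1) (sym (count-split C (fixed g))) ⟩
        count (fixed g) + 1                               ≡⟨ ℕₚ.+-comm _ 1 ⟩
        suc (count (fixed g))                             ≤⟨ g<f ⟩
        count (fixed f)                                   ≡⟨ count-split C (fixed f) ⟩
        count (C ∩ fixed f) + count (∁ C ∩ fixed f)       ≡⟨ cong (_+ count (∁ C ∩ fixed f)) balance ⟩
        count (C ∩ fixed g) + count (∁ C ∩ fixed f)       ∎)
    ... | x , x∈ with C x in x∉
    ...   | false = x , record
      { x∉C = x∉
      ; g-closed = g-closed
      ; f-closed = closed
      ; balance = trans (count-insert C (fixed f) x∉) (cong₂ _+_ (cong 𝟙 x∈) balance)
      }
      where
      closed : Closed f (insert x C)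
      closed v v∈ with insert⁻ x C v v∈
      ... | inj₁ refl = trans (cong (insert x C) (does⇒ (f x ≟ x) x∈)) (insert-here x C)
      ... | inj₂ v∈C  = insert-there x C (f v) (f-closed v v∈C)

    -- A path that ends at a fixed point of `g` has one fixed point of each kind; it is absorbed as
    -- a balanced component and another path is started. A path that ends at a second fixed point of
    -- `f` gives the surplus. The fuel `k` bounds the number of vertices outside `C`, which drops
    -- with every call.
    walk : ∀ k {C x} → count (∁ C) < k → Walk C x → Surplus
    walk (suc k) {C} {x} (s≤s bound) w with g x ≟ x
    ... | yes gx≡x = walk k (decrease bound) (proj₂ (start (Walk.f-closed w) closed balanced))
      where
      open Walk w
      decrease : count (∁ C) ≤ k → count (∁ (insert x C)) < k
      decrease = subst (_≤ k) (count-∁-insert C x∉C)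
      closed : Closed g (insert x C)
      closed v v∈ with insert⁻ x C v v∈
      ... | inj₁ refl = trans (cong (insert x C) gx≡x) (insert-here x C)
      ... | inj₂ v∈C  = insert-there x C (g v) (g-closed v v∈C)
      balanced : count (insert x C ∩ fixed f) ≡ count (insert x C ∩ fixed g)
      balanced = trans balance (sym (trans (count-insert C (fixed g) x∉C)
        (cong (λ b → 𝟙 b + count (C ∩ fixed g)) (dec-true (g x ≟ x) gx≡x))))
    ... | no gx≢x = continue (f y ≟ y)
      where
      open Walk w
      -- The path leaves `x` along its `g`-edge to `y`. If `y` also has an `f`-edge, the other end
      -- of that edge is the next `x`.
      y  = g x
      C₁ = insert x C
      C₂ = insert y C₁
      y∉C₁ : C₁ y ≡ false
      y∉C₁ = ∉-insert C gx≢x (closed⁻ g-inv g-closed x x∉C)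
      fy∉C₁ : C₁ (f y) ≡ false
      fy∉C₁ = closed⁻ f-inv f-closed y y∉C₁
      g-closed₂ : Closed g C₂
      g-closed₂ v v∈ with insert⁻ y C₁ v v∈
      ... | inj₁ refl = trans (cong C₂ (g-inv x)) (insert-there y C₁ x (insert-here x C))
      ... | inj₂ v∈C₁ with insert⁻ x C v v∈C₁
      ...   | inj₁ refl = insert-here y C₁
      ...   | inj₂ v∈C  = insert-there y C₁ (g v) (insert-there x C (g v) (g-closed v v∈C))
      count-g : count (C₂ ∩ fixed g) ≡ count (C ∩ fixed g)
      count-g = begin
        count (C₂ ∩ fixed g)                          ≡⟨ count-insert C₁ (fixed g) y∉C₁ ⟩
        𝟙 (fixed g y) + count (C₁ ∩ fixed g)          ≡⟨ cong (λ b → 𝟙 b + count (C₁ ∩ fixed g))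
                                                           (dec-false (g y ≟ y) λ gy≡y → gx≢x (trans (sym gy≡y) (g-inv x))) ⟩
        count (C₁ ∩ fixed g)                          ≡⟨ count-insert C (fixed g) x∉C ⟩
        𝟙 (fixed g x) + count (C ∩ fixed g)           ≡⟨ cong (λ b → 𝟙 b + count (C ∩ fixed g)) (dec-false (g x ≟ x) gx≢x) ⟩
        count (C ∩ fixed g)                           ∎
        where open ≡-Reasoning
      count-f : ∀ {b} → fixed f y ≡ b → count (C₂ ∩ fixed f) ≡ 𝟙 b + suc (count (C₂ ∩ fixed g))
      count-f refl = trans (count-insert C₁ (fixed f) y∉C₁)
        (cong (𝟙 (fixed f y) +_) (trans balance (cong suc (sym count-g))))
      continue : Dec (f y ≡ y) → Surplus
      continue (yes fy≡y) = C₂ , closed , g-closed₂ , count-f (dec-true (f y ≟ y) fy≡y)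
        where
        closed : Closed f C₂
        closed v v∈ with insert⁻ y C₁ v v∈
        ... | inj₁ refl = trans (cong C₂ fy≡y) (insert-here y C₁)
        ... | inj₂ v∈C₁ = insert-there y C₁ (f v) (f-closed v v∈C₁)
      continue (no fy≢y) = walk k decrease record
        { x∉C = z∉C₂ ; g-closed = g-closed₂ ; f-closed = closed
        ; balance = trans (count-insert C₂ (fixed f) z∉C₂) (cong₂ _+_
            (cong 𝟙 (dec-false (f z ≟ z) λ fz≡z → fy≢y (trans (sym fz≡z) (f-inv y))))
            (count-f (dec-false (f y ≟ y) fy≢y)))
        }
        where
        z = f y
        z∉C₂ : C₂ z ≡ false
        z∉C₂ = ∉-insert C₁ fy≢y fy∉C₁
        decrease : count (∁ C₂) < k
        decrease = begin
          suc (count (∁ C₂))   ≡⟨ sym (count-∁-insert C₁ y∉C₁) ⟩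
          count (∁ C₁)         ≤⟨ ℕₚ.n≤1+n _ ⟩
          suc (count (∁ C₁))   ≡⟨ sym (count-∁-insert C x∉C) ⟩
          count (∁ C)          ≤⟨ bound ⟩
          k                    ∎
          where open ≤-Reasoning
        closed : Closed f (insert z C₂)
        closed v v∈ with insert⁻ z C₂ v v∈
        ... | inj₁ refl = trans (cong (insert z C₂) (f-inv y)) (insert-there z C₂ y (insert-here y C₁))
        ... | inj₂ v∈C₂ with insert⁻ y C₁ v v∈C₂
        ...   | inj₁ refl = insert-here z C₂
        ...   | inj₂ v∈C₁ = insert-there z C₂ (f v) (insert-there y C₁ (f v) (f-closed v v∈C₁))

    surplus : Surplus
    surplus = walk _ ℕₚ.≤-refl (proj₂ (start {∅} (λ _ ()) (λ _ ()) refl))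

-- Exchanging one involution for another on a closed set

splice : (Fin n → Bool) → (Fin n → Fin n) → (Fin n → Fin n) → Fin n → Fin n
splice C f g v = if C v then g v else f v

dist : (Fin n → Fin n) → (Fin n → Fin n) → ℕ
dist f g = count (λ v → not (f v == g v))

module _ (C : Fin n → Bool) (f g : Fin n → Fin n) where

  splice-in : ∀ {v} → C v ≡ true → splice C f g v ≡ g v
  splice-in v∈ rewrite v∈ = refl

  splice-out : ∀ {v} → C v ≡ false → splice C f g v ≡ f v
  splice-out v∉ rewrite v∉ = refl

  splice-involutive : Involutive f → Involutive g → Closed f C → Closed g C → Involutive (splice C f g)
  splice-involutive f-inv g-inv f-closed g-closed v with C v in eq
  ... | true  = trans (splice-in (g-closed v eq)) (g-inv v)
  ... | false = trans (splice-out (closed⁻ f-inv f-closed v eq)) (f-inv v)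

  -- On `C` the fixed points of `f` are traded for those of `g`; the additive form avoids truncated
  -- subtraction.
  count-fixed-splice : count (fixed (splice C f g)) + count (C ∩ fixed f) ≡
                       count (fixed f) + count (C ∩ fixed g)
  count-fixed-splice = begin
    count (fixed (splice C f g)) + count (C ∩ fixed f)                   ≡⟨ sym (∑-distrib-+ (𝟙 ∘ fixed (splice C f g)) _) ⟩
    sum (λ v → 𝟙 (fixed (splice C f g) v) + 𝟙 ((C ∩ fixed f) v))         ≡⟨ sum-cong-≗ pointwise ⟩
    sum (λ v → 𝟙 (fixed f v) + 𝟙 ((C ∩ fixed g) v))                      ≡⟨ ∑-distrib-+ (𝟙 ∘ fixed f) _ ⟩
    count (fixed f) + count (C ∩ fixed g)                                ∎
    where
    open ≡-Reasoning
    pointwise : ∀ v → 𝟙 (fixed (splice C f g) v) + 𝟙 ((C ∩ fixed f) v) ≡ 𝟙 (fixed f v) + 𝟙 ((C ∩ fixed g) v)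
    pointwise v with C v
    ... | true  = ℕₚ.+-comm (𝟙 (fixed g v)) _
    ... | false = refl

  splice-surplus : count (C ∩ fixed f) ≡ 2 + count (C ∩ fixed g) →
                   count (fixed f) ≡ 2 + count (fixed (splice C f g))
  splice-surplus balance = ℕₚ.+-cancelʳ-≡ (count (C ∩ fixed g)) _ _ (begin
    count (fixed f) + count (C ∩ fixed g)                          ≡⟨ sym count-fixed-splice ⟩
    count (fixed (splice C f g)) + count (C ∩ fixed f)             ≡⟨ cong (count (fixed (splice C f g)) +_) balance ⟩
    count (fixed (splice C f g)) + (2 + count (C ∩ fixed g))       ≡⟨ shift (count (fixed (splice C f g))) _ ⟩
    2 + count (fixed (splice C f g)) + count (C ∩ fixed g)         ∎)
    where
    open ≡-Reasoning
    shift : ∀ a b → a + (2 + b) ≡ 2 + a + b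
    shift = solve-∀

  count-fixed-splice-∁ : count (fixed (splice C f g)) + count (fixed (splice (∁ C) f g)) ≡
                         count (fixed f) + count (fixed g)
  count-fixed-splice-∁ = begin
    count (fixed (splice C f g)) + count (fixed (splice (∁ C) f g))              ≡⟨ sym (∑-distrib-+ (𝟙 ∘ fixed (splice C f g)) _) ⟩
    sum (λ v → 𝟙 (fixed (splice C f g) v) + 𝟙 (fixed (splice (∁ C) f g) v))      ≡⟨ sum-cong-≗ pointwise ⟩
    sum (λ v → 𝟙 (fixed f v) + 𝟙 (fixed g v))                                    ≡⟨ ∑-distrib-+ (𝟙 ∘ fixed f) _ ⟩
    count (fixed f) + count (fixed g)                                            ∎
    where
    open ≡-Reasoning
    pointwise : ∀ v → 𝟙 (fixed (splice C f g) v) + 𝟙 (fixed (splice (∁ C) f g) v) ≡ 𝟙 (fixed f v) + 𝟙 (fixed g v)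
    pointwise v with C v
    ... | true  = ℕₚ.+-comm (𝟙 (fixed g v)) _
    ... | false = refl

  -- Every disagreement of `f` and `g` is inherited by exactly one of the two splices.
  dist-splice-∁ : dist f (splice C f g) + dist f (splice (∁ C) f g) ≡ dist f g
  dist-splice-∁ = trans (sym (∑-distrib-+ (λ v → 𝟙 (not (f v == splice C f g v))) _)) (sum-cong-≗ pointwise)
    where
    pointwise : ∀ v → 𝟙 (not (f v == splice C f g v)) + 𝟙 (not (f v == splice (∁ C) f g v)) ≡ 𝟙 (not (f v == g v))
    pointwise v with C v
    ... | true  rewrite dec-true (f v ≟ f v) refl = ℕₚ.+-identityʳ _
    ... | false rewrite dec-true (f v ≟ f v) refl = refl

dist-≤ : ∀ {g h : Fin n → Fin n} (S : Fin n → Bool) → (∀ v → S v ≡ false → h v ≡ g v) →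
         ∀ f → dist f h ≤ dist f g + count S
dist-≤ {g = g} {h} S agree f = ℕₚ.≤-trans (sum-mono-≤ pointwise)
  (ℕₚ.≤-reflexive (∑-distrib-+ (λ v → 𝟙 (not (f v == g v))) _))
  where
  𝟙≤1 : ∀ b → 𝟙 b ≤ 1
  𝟙≤1 true  = ℕₚ.≤-refl
  𝟙≤1 false = z≤n
  pointwise : ∀ v → 𝟙 (not (f v == h v)) ≤ 𝟙 (not (f v == g v)) + 𝟙 (S v)
  pointwise v with S v in eq
  ... | true  = ℕₚ.≤-trans (𝟙≤1 _) (ℕₚ.m≤n+m 1 _)
  ... | false rewrite agree v eq = ℕₚ.m≤m+n _ 0

-- Matchings of the complement graph

link : Fin n → Fin n → (Fin n → Fin n) → Fin n → Fin n
link p q f v = if v == p then q else if v == q then p else f v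

module _ (p q : Fin n) (f : Fin n → Fin n) where

  link-left : link p q f p ≡ q
  link-left rewrite dec-true (p ≟ p) refl = refl

  link-right : p ≢ q → link p q f q ≡ p
  link-right p≢q rewrite dec-false (q ≟ p) (p≢q ∘ sym) | dec-true (q ≟ q) refl = refl

  link-off : ∀ {v} → v ≢ p → v ≢ q → link p q f v ≡ f v
  link-off {v} v≢p v≢q rewrite dec-false (v ≟ p) v≢p | dec-false (v ≟ q) v≢q = refl

module _ (G : Graph n) where

  -- An edge of the complement joins v to mate v when mate v differs from v;
  -- the fixed points of mate are the unmatched vertices.
  record Matching : Set where
    field
      mate       : Fin n → Fin n
      involutive : Involutive mate
      nonadj     : ∀ v → ¬ Adj G v (mate v)

  open Matching

  unmatched : Matching → ℕ
  unmatched m = count (fixed (mate m))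

  -- For x = b this forbids augmenting paths of length one, and for matched x
  -- augmenting paths a, x, mate x, b of length three.
  Stuck : (Fin n → Fin n) → Set
  Stuck f = ∀ a b x → a ≢ b → f a ≡ a → f b ≡ b → Adj G a x ⊎ Adj G b (f x)

  Augmentable : (Fin n → Fin n) → Set
  Augmentable f = ∃[ a ] ∃[ b ] ∃[ x ] a ≢ b × f a ≡ a × f b ≡ b × ¬ Adj G a x × ¬ Adj G b (f x)

  stuck⊎augmentable : ∀ f → Stuck f ⊎ Augmentable f
  stuck⊎augmentable f
    with any? (λ a → any? λ b → any? λ x → ¬? (a ≟ b) ×-dec f a ≟ a ×-dec f b ≟ b ×-dec
                                           ¬? (adj? G a x) ×-dec ¬? (adj? G b (f x)))
  ... | yes aug = inj₂ aug
  ... | no ¬aug = inj₁ stuck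
    where
    stuck : Stuck f
    stuck a b x a≢b fa fb with adj? G a x | adj? G b (f x)
    ... | yes ax | _       = inj₁ ax
    ... | no _   | yes bfx = inj₂ bfx
    ... | no ¬ax | no ¬bfx = ⊥-elim (¬aug (a , b , x , a≢b , fa , fb , ¬ax , ¬bfx))

  identity : Matching
  identity = record { mate = id ; involutive = λ _ → refl ; nonadj = λ _ → irrefl G refl }

  spliceᴹ : ∀ C (m m′ : Matching) → Closed (mate m) C → Closed (mate m′) C → Matching
  spliceᴹ C m m′ closed closed′ = record
    { mate = splice C (mate m) (mate m′)
    ; involutive = splice-involutive C (mate m) (mate m′) (involutive m) (involutive m′) closed closed′
    ; nonadj = nonadjacent
    }
    where
    nonadjacent : ∀ v → ¬ Adj G v (splice C (mate m) (mate m′) v)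
    nonadjacent v with C v
    ... | true  = nonadj m′ v
    ... | false = nonadj m v

  module _ (m : Matching) {p q : Fin n} (p≢q : p ≢ q)
           (fp : mate m p ≡ p) (fq : mate m q ≡ q) (¬pq : ¬ Adj G p q) where

    private
      f = mate m

    linkᴹ : Matching
    linkᴹ = record { mate = link p q f ; involutive = inv ; nonadj = nonadjacent }
      where
      inv : Involutive (link p q f)
      inv v with v ≟ p | v ≟ q
      ... | yes refl | _        = link-right p q f p≢q
      ... | no _     | yes refl = link-left p q f
      ... | no v≢p   | no v≢q   = trans
        (link-off p q f (λ fv≡p → v≢p (trans (sym (involutive m v)) (trans (cong f fv≡p) fp)))
                        (λ fv≡q → v≢q (trans (sym (involutive m v)) (trans (cong f fv≡q) fq))))
        (involutive m v)
      nonadjacent : ∀ v → ¬ Adj G v (link p q f v)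
      nonadjacent v with v ≟ p | v ≟ q
      ... | yes refl | _        = ¬pq
      ... | no _     | yes refl = ¬pq ∘ symm G
      ... | no _     | no _     = nonadj m v

    unmatched-link : unmatched m ≡ 2 + unmatched linkᴹ
    unmatched-link = begin
      unmatched m                                                            ≡⟨ sum-cong-≗ pointwise ⟩
      sum (λ v → 𝟙 (v == p) + (𝟙 (v == q) + 𝟙 (fixed (link p q f) v)))       ≡⟨ ∑-distrib-+ (λ v → 𝟙 (v == p)) _ ⟩
      count (_== p) + sum (λ v → 𝟙 (v == q) + 𝟙 (fixed (link p q f) v))      ≡⟨ cong₂ _+_ (count-== p) (∑-distrib-+ (λ v → 𝟙 (v == q)) _) ⟩
      suc (count (_== q) + unmatched linkᴹ)                                  ≡⟨ cong (λ k → suc (k + unmatched linkᴹ)) (count-== q) ⟩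
      2 + unmatched linkᴹ                                                    ∎
      where
      open ≡-Reasoning
      pointwise : ∀ v → 𝟙 (fixed f v) ≡ 𝟙 (v == p) + (𝟙 (v == q) + 𝟙 (fixed (link p q f) v))
      pointwise v with v ≟ p | v ≟ q
      ... | yes refl | yes v≡q  = ⊥-elim (p≢q v≡q)
      ... | yes refl | no _     rewrite dec-true (f v ≟ v) fp | dec-false (q ≟ v) (p≢q ∘ sym) = refl
      ... | no _     | yes refl rewrite dec-true (f v ≟ v) fq | dec-false (p ≟ v) p≢q = refl
      ... | no _     | no _     = refl

  module _ (m : Matching) {x : Fin n} (fx≢x : mate m x ≢ x) where

    private
      f = mate m
      edge = insert x (insert (f x) ∅)

      edge⁻ : ∀ v → edge v ≡ true → v ≡ x ⊎ v ≡ f x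
      edge⁻ v v∈ with insert⁻ x (insert (f x) ∅) v v∈
      ... | inj₁ v≡x = inj₁ v≡x
      ... | inj₂ v∈′ with insert⁻ (f x) ∅ v v∈′
      ...   | inj₁ v≡fx = inj₂ v≡fx

      closed : Closed f edge
      closed v v∈ with edge⁻ v v∈
      ... | inj₁ refl = insert-there x (insert (f x) ∅) (f x) (insert-here (f x) ∅)
      ... | inj₂ refl = trans (cong edge (involutive m x)) (insert-here x (insert (f x) ∅))

    -- Removing an edge is splicing in the identity on its two ends, so that `count-fixed-splice`
    -- also counts the new unmatched vertices.
    unlinkᴹ : Matching
    unlinkᴹ = spliceᴹ edge m identity closed (λ _ v∈ → v∈)

    unlink-left : mate unlinkᴹ x ≡ x
    unlink-left = splice-in edge f id (insert-here x (insert (f x) ∅))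

    unlink-right : mate unlinkᴹ (f x) ≡ f x
    unlink-right = splice-in edge f id
      (insert-there x (insert (f x) ∅) (f x) (insert-here (f x) ∅))

    unlink-off : ∀ {v} → v ≢ x → v ≢ f x → mate unlinkᴹ v ≡ f v
    unlink-off {v} v≢x v≢fx = splice-out edge f id
      (∉-insert (insert (f x) ∅) v≢x (∉-insert ∅ v≢fx refl))

    unmatched-unlink : unmatched unlinkᴹ ≡ 2 + unmatched m
    unmatched-unlink = begin
      unmatched unlinkᴹ                                ≡⟨ sym (ℕₚ.+-identityʳ _) ⟩
      unmatched unlinkᴹ + 0                            ≡⟨ cong (unmatched unlinkᴹ +_) (sym none) ⟩
      unmatched unlinkᴹ + count (edge ∩ fixed f)       ≡⟨ count-fixed-splice edge f id ⟩
      unmatched m + count (edge ∩ fixed id)            ≡⟨ cong (unmatched m +_) two ⟩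
      unmatched m + 2                                  ≡⟨ ℕₚ.+-comm _ 2 ⟩
      2 + unmatched m                                  ∎
      where
      open ≡-Reasoning
      count-edge : ∀ q → count (edge ∩ q) ≡ 𝟙 (q x) + (𝟙 (q (f x)) + 0)
      count-edge q = trans (count-insert (insert (f x) ∅) q (∉-insert ∅ (fx≢x ∘ sym) refl))
        (cong (𝟙 (q x) +_) (trans (count-insert ∅ q refl)
          (cong (𝟙 (q (f x)) +_) (count-none (∅ ∩ q) λ _ → refl))))
      none : count (edge ∩ fixed f) ≡ 0
      none rewrite count-edge (fixed f) | dec-false (f x ≟ x) fx≢x
                 | dec-false (f (f x) ≟ f x) (λ ffx≡fx → fx≢x (trans (sym ffx≡fx) (involutive m x))) = refl
      two : count (edge ∩ fixed id) ≡ 2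
      two rewrite count-edge (fixed id) | dec-true (x ≟ x) refl | dec-true (f x ≟ f x) refl = refl

  -- Augmentation along short paths

  record Augmentation (m : Matching) : Set where
    field
      next : Matching
      size : unmatched m ≡ 2 + unmatched next
      -- The distance is measured from an arbitrary `f`, since the reference matching of the descent
      -- is not the one that gets augmented.
      near : ∀ f → dist f (mate next) ≤ dist f (mate m) + 4

  near-four : ∀ {g h : Fin n → Fin n} a b c d →
              (∀ v → v ≢ a → v ≢ b → v ≢ c → v ≢ d → h v ≡ g v) →
              ∀ f → dist f h ≤ dist f g + 4
  near-four {g} {h} a b c d agree f = ℕₚ.≤-trans (dist-≤ abcd agree′ f) (ℕₚ.+-monoʳ-≤ (dist f g) count≤4)
    where
    cd   = insert c (insert d ∅)
    abcd = insert a (insert b cd)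
    agree′ : ∀ v → abcd v ≡ false → h v ≡ g v
    agree′ v v∉ with ∉-insert⁻ a (insert b cd) v v∉
    ... | v≢a , v∉₁ with ∉-insert⁻ b cd v v∉₁
    ...   | v≢b , v∉₂ with ∉-insert⁻ c (insert d ∅) v v∉₂
    ...     | v≢c , v∉₃ = agree v v≢a v≢b v≢c (proj₁ (∉-insert⁻ d ∅ v v∉₃))
    count≤4 : count abcd ≤ 4
    count≤4 = ℕₚ.≤-trans (count-insert-≤ (insert b cd) a) (s≤s
              (ℕₚ.≤-trans (count-insert-≤ cd b) (s≤s
              (ℕₚ.≤-trans (count-insert-≤ (insert d ∅) c) (s≤s
              (ℕₚ.≤-trans (count-insert-≤ ∅ d) (s≤s
              (ℕₚ.≤-reflexive (count-none {n} ∅ λ _ → refl)))))))))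

  augment-edge : ∀ (m : Matching) {p q} → p ≢ q → mate m p ≡ p → mate m q ≡ q → ¬ Adj G p q → Augmentation m
  augment-edge m {p} {q} p≢q fp fq ¬pq = record
    { next = linkᴹ m p≢q fp fq ¬pq
    ; size = unmatched-link m p≢q fp fq ¬pq
    -- Only two mates change, so `p` and `q` fill the four places twice.
    ; near = near-four p q p q λ _ v≢p v≢q _ _ → link-off p q (mate m) v≢p v≢q
    }

  augment : ∀ (m : Matching) → Augmentable (mate m) → Augmentation m
  augment m (a , b , x , a≢b , fa , fb , ¬ax , ¬bfx) with mate m x ≟ x
  ... | yes fx≡x with a ≟ x
  -- Here `a` is `x` and unmatched, so the non-edge between `b` and `f x` is the one between `b` and
  -- `a`.
  ...   | yes refl = augment-edge m a≢b fa fb (λ ab → ¬bfx (subst (Adj G b) (sym fx≡x) (symm G ab)))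
  ...   | no a≢x   = augment-edge m a≢x fa fx≡x ¬ax
  augment m (a , b , x , a≢b , fa , fb , ¬ax , ¬bfx) | no fx≢x = record
    { next = m₃
    ; size = ℕₚ.+-cancelˡ-≡ 2 _ _ (begin
        -- Removing the edge at `x` frees two vertices and the two new edges cover four.
        2 + unmatched m    ≡⟨ sym (unmatched-unlink m fx≢x) ⟩
        unmatched m₁       ≡⟨ unmatched-link m₁ a≢x a₁ (unlink-left m fx≢x) ¬ax ⟩
        2 + unmatched m₂   ≡⟨ cong (2 +_) (unmatched-link m₂ b≢y b₂ y₂ ¬bfx) ⟩
        4 + unmatched m₃   ∎)
    ; near = near-four a x b y λ v v≢a v≢x v≢b v≢y → begin
        mate m₃ v   ≡⟨ link-off b y (mate m₂) v≢b v≢y ⟩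
        mate m₂ v   ≡⟨ link-off a x (mate m₁) v≢a v≢x ⟩
        mate m₁ v   ≡⟨ unlink-off m fx≢x v≢x v≢y ⟩
        mate m v    ∎
    }
    where
    open ≡-Reasoning
    f = mate m
    y = f x
    fy≢y : f y ≢ y
    fy≢y fy≡y = fx≢x (trans (sym fy≡y) (involutive m x))
    ≢x : ∀ {v} → f v ≡ v → v ≢ x
    ≢x fv refl = fx≢x fv
    ≢y : ∀ {v} → f v ≡ v → v ≢ y
    ≢y fv refl = fy≢y fv
    a≢x = ≢x fa
    b≢y = ≢y fb
    m₁ = unlinkᴹ m fx≢x
    a₁ : mate m₁ a ≡ a
    a₁ = trans (unlink-off m fx≢x (≢x fa) (≢y fa)) fa
    m₂ = linkᴹ m₁ a≢x a₁ (unlink-left m fx≢x) ¬ax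
    b₂ : mate m₂ b ≡ b
    b₂ = trans (link-off a x (mate m₁) (a≢b ∘ sym) (≢x fb))
               (trans (unlink-off m fx≢x (≢x fb) b≢y) fb)
    y₂ : mate m₂ y ≡ y
    y₂ = trans (link-off a x (mate m₁) (≢y fa ∘ sym) fx≢x) (unlink-right m fx≢x)
    m₃ = linkᴹ m₂ b≢y b₂ y₂ ¬bfx

  -- Some two vertices `a`, `b` are unmatched in `m` but matched in `m′`. Their `m′`-mates `x`, `x′`
  -- are matched in `m`, and the `m`-mate `y` of `x` is not `x′`, since otherwise `a`, `x`, `y`, `b`
  -- would be an augmenting path of length three for `m`. All five vertices change their mates.
  stuck⇒far : ∀ (m m′ : Matching) → Stuck (mate m) → unmatched m ≡ 2 + unmatched m′ →
              4 < dist (mate m) (mate m′)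
  stuck⇒far m m′ stuck size = far (count-∃ lost (ℕₚ.≤-trans (s≤s z≤n) two))
    where
    f = mate m
    g = mate m′
    lost : Fin n → Bool
    lost = ∁ (fixed g) ∩ fixed f
    two : 2 ≤ count lost
    two = ℕₚ.+-cancelʳ-≤ (unmatched m′) 2 _ (begin
      2 + unmatched m′                          ≡⟨ sym size ⟩
      unmatched m                               ≡⟨ count-split (fixed g) (fixed f) ⟩
      count (fixed g ∩ fixed f) + count lost    ≤⟨ ℕₚ.+-monoˡ-≤ _ (sum-mono-≤ λ v → 𝟙-∧ (fixed g v) (fixed f v)) ⟩
      unmatched m′ + count lost                 ≡⟨ ℕₚ.+-comm (unmatched m′) _ ⟩
      count lost + unmatched m′                 ∎)
      where
      open ≤-Reasoning
      𝟙-∧ : ∀ b c → 𝟙 (b ∧ c) ≤ 𝟙 b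
      𝟙-∧ true  true  = ℕₚ.≤-refl
      𝟙-∧ true  false = z≤n
      𝟙-∧ false _     = z≤n
    lost⁻ : ∀ v → lost v ≡ true → f v ≡ v × g v ≢ v
    lost⁻ v v∈ with g v ≟ v | f v ≟ v
    ... | no gv≢v | yes fv≡v = fv≡v , gv≢v
    matched : ∀ {a} → f a ≡ a → g a ≢ a → f (g a) ≢ g a
    -- If `g a` were unmatched in `m`, it would form with `a` an augmenting path of length one.
    matched {a} fa ga≢a fga with stuck a (g a) (g a) (ga≢a ∘ sym) fa fga
    ... | inj₁ adj = nonadj m′ a adj
    ... | inj₂ adj = nonadj m (g a) adj
    far : ∃[ a ] lost a ≡ true → 4 < dist f g
    far (a , a∈) with count-∃ (remove a lost) (ℕₚ.≤-pred (subst (2 ≤_) (count-remove lost a∈) two))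
    ... | b , b∈ with b ≟ a
    ...   | no b≢a = unique⇒length≤count (λ v → not (f v == g v)) {a ∷ b ∷ x ∷ x′ ∷ y ∷ []}
      (((b≢a ∘ sym) ∷ ≢fixed fa fx≢x ∷ ≢fixed fa fx′≢x′ ∷ ≢fixed fa fy≢y ∷ [])
       ∷ (≢fixed fb fx≢x ∷ ≢fixed fb fx′≢x′ ∷ ≢fixed fb fy≢y ∷ [])
       ∷ (x≢x′ ∷ (fx≢x ∘ sym) ∷ [])
       ∷ ((y≢x′ ∘ sym) ∷ [])
       ∷ [] ∷ [])
      ( differ (λ fa≡ga → ga≢a (trans (sym fa≡ga) fa))
      ∷ differ (λ fb≡gb → gb≢b (trans (sym fb≡gb) fb))
      ∷ differ (λ fx≡gx → ≢fixed fa fy≢y (sym (trans fx≡gx (involutive m′ a))))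
      ∷ differ (λ fx′≡gx′ → ≢fixed fb (fixed-free fx′≢x′) (sym (trans fx′≡gx′ (involutive m′ b))))
      -- If the mates of `y` agreed, `y` would be the `m′`-mate of `x`, which is `a`; but `y` is
      -- matched in `m` and `a` is not.
      ∷ differ (λ fy≡gy → ≢fixed fa fy≢y (begin
          a          ≡⟨ sym (involutive m′ a) ⟩
          g x        ≡⟨ cong g (sym (involutive m x)) ⟩
          g (f y)    ≡⟨ cong g fy≡gy ⟩
          g (g y)    ≡⟨ involutive m′ y ⟩
          y          ∎))
      ∷ [])
      where
      open ≡-Reasoning
      fa = proj₁ (lost⁻ a a∈)
      fb = proj₁ (lost⁻ b b∈)
      ga≢a = proj₂ (lost⁻ a a∈)
      gb≢b = proj₂ (lost⁻ b b∈)
      x  = g a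
      x′ = g b
      y  = f x
      fx≢x : f x ≢ x
      fx≢x = matched fa ga≢a
      fx′≢x′ : f x′ ≢ x′
      fx′≢x′ = matched fb gb≢b
      fixed-free : ∀ {v} → f v ≢ v → f (f v) ≢ f v
      fixed-free {v} fv≢v ffv = fv≢v (trans (sym ffv) (involutive m v))
      fy≢y : f y ≢ y
      fy≢y = fixed-free fx≢x
      ≢fixed : ∀ {u v} → f u ≡ u → f v ≢ v → u ≢ v
      ≢fixed fu fv≢v refl = fv≢v fu
      x≢x′ : x ≢ x′
      x≢x′ x≡x′ = b≢a (trans (sym (involutive m′ b)) (trans (cong g (sym x≡x′)) (involutive m′ a)))
      y≢x′ : y ≢ x′
      y≢x′ y≡x′ with stuck a b x (b≢a ∘ sym) fa fb
      ... | inj₁ adj = nonadj m′ a adj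
      ... | inj₂ adj = nonadj m′ b (subst (Adj G b) y≡x′ adj)
      differ : ∀ {v} → f v ≢ g v → not (f v == g v) ≡ true
      differ {v} fv≢gv = cong not (dec-false (f v ≟ g v) fv≢gv)

  -- Descent to a stuck matching with one more edge

  module _ (m : Matching) (stuck : Stuck (mate m)) where

    private
      f = mate m

    Next : Matching → Set
    Next h = unmatched m ≡ 2 + unmatched h

    -- The stuck matching `m` stays fixed while `h` moves towards it; `k` bounds their distance.
    descend : ∀ k (h : Matching) → dist f (mate h) < k → Next h → ∃[ h′ ] Stuck (mate h′) × Next h′
    descend (suc k) h (s≤s bound) size with stuck⊎augmentable (mate h)
    ... | inj₁ stuck-h = h , stuck-h , size
    ... | inj₂ aug = choose (d₁ ℕₚ.<? d₀)
      where
      open Augmentation (augment h aug) renaming (next to h₂; size to size₂)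
      g = mate h₂
      size₃ : unmatched m ≡ 4 + unmatched h₂
      size₃ = trans size (cong (2 +_) size₂)
      component : Surplus {f = f} {g} (involutive m) (involutive h₂)
      component = surplus {f = f} {g} (involutive m) (involutive h₂)
        (ℕₚ.≤-trans (ℕₚ.m≤n+m _ 3) (ℕₚ.≤-reflexive (sym size₃)))
      C = proj₁ component
      f-closed  = proj₁ (proj₂ component)
      h₂-closed = proj₁ (proj₂ (proj₂ component))
      balance   = proj₂ (proj₂ (proj₂ component))
      m₁ = spliceᴹ C m h₂ f-closed h₂-closed
      m₂ = spliceᴹ (∁ C) m h₂ (closed-∁ (involutive m) f-closed) (closed-∁ (involutive h₂) h₂-closed)
      d₀ = dist f (mate h)
      d₁ = dist f (mate m₁)
      d₂ = dist f (mate m₂)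
      next₁ : Next m₁
      next₁ = splice-surplus C f g balance
      -- The two splices together have as many unmatched vertices as `m` and `h₂`, whose numbers
      -- differ by four. Two of the four are taken by `m₁`, which leaves two for `m₂`.
      next₂ : Next m₂
      next₂ = ℕₚ.+-cancelʳ-≡ (unmatched h₂) _ _ (begin
        unmatched m + unmatched h₂          ≡⟨ sym (count-fixed-splice-∁ C f g) ⟩
        unmatched m₁ + unmatched m₂         ≡⟨ cong (_+ unmatched m₂) (ℕₚ.+-cancelˡ-≡ 2 _ _ (trans (sym next₁) size₃)) ⟩
        2 + unmatched h₂ + unmatched m₂     ≡⟨ cong (2 +_) (ℕₚ.+-comm (unmatched h₂) _) ⟩
        2 + unmatched m₂ + unmatched h₂     ∎)
        where open ≡-Reasoning
      choose : Dec (d₁ < d₀) → ∃[ h′ ] Stuck (mate h′) × Next h′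
      choose (yes d₁<d₀) = descend k m₁ (ℕₚ.≤-trans d₁<d₀ bound) next₁
      -- The two parts are never compared with each other: `d₀ ≤ d₁` forces `d₂` to be at most 4,
      -- and `d₀` is at least 5.
      choose (no d₁≮d₀)  = descend k m₂ (begin
        suc d₂   ≤⟨ s≤s (ℕₚ.+-cancelˡ-≤ d₀ _ _ (begin
                     d₀ + d₂           ≤⟨ ℕₚ.+-monoˡ-≤ d₂ (ℕₚ.≮⇒≥ d₁≮d₀) ⟩
                     d₁ + d₂           ≡⟨ dist-splice-∁ C f g ⟩
                     dist f g          ≤⟨ near f ⟩
                     d₀ + 4            ∎)) ⟩
        5        ≤⟨ stuck⇒far m h stuck size ⟩
        d₀       ≤⟨ bound ⟩
        k        ∎) next₂
        where open ≤-Reasoning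

    -- The given `h` may exceed `m` by many edges; exchanging on one surplus set gains exactly one
    -- edge, and this starts the descent.
    smaller : ∀ (h : Matching) → unmatched h < unmatched m → ∃[ h′ ] Stuck (mate h′) × Next h′
    smaller h h<m with surplus {f = f} {mate h} (involutive m) (involutive h) h<m
    ... | C , f-closed , h-closed , balance =
      descend _ (spliceᴹ C m h f-closed h-closed) ℕₚ.≤-refl (splice-surplus C f (mate h) balance)

-- Colorings with classes of size at most two

-- One vertex of each class: the smaller of two mates, or an unmatched vertex itself.
reps : (Fin n → Fin n) → Fin n → Bool
reps f v = does (toℕ v ≤? toℕ (f v))

-- Since `f` permutes the vertices, the second copy of the count may be taken at `f v`. Of the tests
-- `v ≤ f v` and `f v ≤ v` exactly one succeeds, or both at a fixed point.
count-reps : ∀ {f : Fin n → Fin n} → Involutive f → count (reps f) + count (reps f) ≡ n + count (fixed f)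
count-reps {n} {f} f-inv = begin
  count (reps f) + count (reps f)                    ≡⟨ cong (count (reps f) +_) (sum-permute (𝟙 ∘ reps f) π) ⟩
  count (reps f) + count (reps f ∘ f)                ≡⟨ sym (∑-distrib-+ (𝟙 ∘ reps f) _) ⟩
  sum (λ v → 𝟙 (reps f v) + 𝟙 (reps f (f v)))        ≡⟨ sum-cong-≗ pointwise ⟩
  sum (λ v → 1 + 𝟙 (fixed f v))                      ≡⟨ ∑-distrib-+ {n} (λ _ → 1) _ ⟩
  sum {n} (λ _ → 1) + count (fixed f)                ≡⟨ cong (_+ count (fixed f)) (count-all n) ⟩
  n + count (fixed f)                                ∎
  where
  open ≡-Reasoning
  π : Permutation n n
  π = permutation f f f-inv f-inv
  pointwise : ∀ v → 𝟙 (reps f v) + 𝟙 (reps f (f v)) ≡ 1 + 𝟙 (fixed f v)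
  pointwise v rewrite f-inv v with f v ≟ v
  ... | yes fv≡v rewrite fv≡v | dec-true (toℕ v ≤? toℕ v) ℕₚ.≤-refl = refl
  ... | no fv≢v with ℕₚ.<-cmp (toℕ v) (toℕ (f v))
  ...   | tri< v<fv _ v≯fv rewrite dec-true (toℕ v ≤? toℕ (f v)) (ℕₚ.<⇒≤ v<fv)
                                 | dec-false (toℕ (f v) ≤? toℕ v) (ℕₚ.<⇒≱ v<fv) = refl
  ...   | tri≈ _ v≡fv _ = ⊥-elim (fv≢v (sym (toℕ-injective v≡fv)))
  ...   | tri> v≮fv _ v>fv rewrite dec-true (toℕ (f v) ≤? toℕ v) (ℕₚ.<⇒≤ v>fv)
                                 | dec-false (toℕ v ≤? toℕ (f v)) (ℕₚ.<⇒≱ v>fv) = refl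

module _ (G : Graph n) {α : ℕ} (stability : IsStability G α) (α≤2 : α ≤ 2) where

  open Matching

  -- This is the form in which `α ≤ 2` enters everywhere: the complement has no triangle. Two strict
  -- enlargements of a singleton show that the set has more than two elements.
  no-stable-triple : ∀ {u v w} → u ≢ v → u ≢ w → v ≢ w →
                     ¬ Adj G u v → ¬ Adj G u w → ¬ Adj G v w → ⊥
  no-stable-triple {u} {v} {w} u≢v u≢w v≢w ¬uv ¬uw ¬vw =
    ℕₚ.<⇒≱ three (ℕₚ.≤-trans (proj₂ stability ∣ S ∣ (S , stable , refl)) α≤2)
    where
    S : Subset n
    S = (⁅ u ⁆ ∪ ⁅ v ⁆) ∪ ⁅ w ⁆
    member : ∀ {x} → x ∈ S → x ≡ u ⊎ x ≡ v ⊎ x ≡ w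
    member x∈ with x∈p∪q⁻ (⁅ u ⁆ ∪ ⁅ v ⁆) ⁅ w ⁆ x∈
    ... | inj₂ x∈w = inj₂ (inj₂ (x∈⁅y⁆⇒x≡y w x∈w))
    ... | inj₁ x∈uv with x∈p∪q⁻ ⁅ u ⁆ ⁅ v ⁆ x∈uv
    ...   | inj₁ x∈u = inj₁ (x∈⁅y⁆⇒x≡y u x∈u)
    ...   | inj₂ x∈v = inj₂ (inj₁ (x∈⁅y⁆⇒x≡y v x∈v))
    stable : IsStable G S
    stable x∈ y∈ with member x∈ | member y∈
    ... | inj₁ refl        | inj₁ refl        = irrefl G refl
    ... | inj₁ refl        | inj₂ (inj₁ refl) = ¬uv
    ... | inj₁ refl        | inj₂ (inj₂ refl) = ¬uw
    ... | inj₂ (inj₁ refl) | inj₁ refl        = ¬uv ∘ symm G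
    ... | inj₂ (inj₁ refl) | inj₂ (inj₁ refl) = irrefl G refl
    ... | inj₂ (inj₁ refl) | inj₂ (inj₂ refl) = ¬vw
    ... | inj₂ (inj₂ refl) | inj₁ refl        = ¬uw ∘ symm G
    ... | inj₂ (inj₂ refl) | inj₂ (inj₁ refl) = ¬vw ∘ symm G
    ... | inj₂ (inj₂ refl) | inj₂ (inj₂ refl) = irrefl G refl
    u⊂uv : ⁅ u ⁆ ⊂ ⁅ u ⁆ ∪ ⁅ v ⁆
    u⊂uv = p⊆p∪q ⁅ v ⁆ , v , q⊆p∪q ⁅ u ⁆ ⁅ v ⁆ (x∈⁅x⁆ v) , λ v∈ → u≢v (sym (x∈⁅y⁆⇒x≡y u v∈))
    uv⊂S : ⁅ u ⁆ ∪ ⁅ v ⁆ ⊂ S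
    uv⊂S = p⊆p∪q ⁅ w ⁆ , w , q⊆p∪q (⁅ u ⁆ ∪ ⁅ v ⁆) ⁅ w ⁆ (x∈⁅x⁆ w) , λ w∈ →
      [ (λ w∈u → u≢w (sym (x∈⁅y⁆⇒x≡y u w∈u))) , (λ w∈v → v≢w (sym (x∈⁅y⁆⇒x≡y v w∈v))) ]′
        (x∈p∪q⁻ ⁅ u ⁆ ⁅ v ⁆ w∈)
    three : 2 < ∣ S ∣
    three = ℕₚ.≤-trans (s≤s (subst (_< ∣ ⁅ u ⁆ ∪ ⁅ v ⁆ ∣) (∣⁅x⁆∣≡1 u) (p⊂q⇒∣p∣<∣q∣ u⊂uv)))
                       (p⊂q⇒∣p∣<∣q∣ uv⊂S)

  -- From colorings to matchings of the complement

  module _ {t : ℕ} (c : Fin n → Fin t) (proper : IsProper G c) where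

    classmate? : ∀ v → Dec (∃[ w ] w ≢ v × c w ≡ c v)
    classmate? v = any? λ w → ¬? (w ≟ v) ×-dec c w ≟ c v

    partner : Fin n → Fin n
    partner v with classmate? v
    ... | yes (w , _) = w
    ... | no _        = v

    same-class : ∀ {u v} → c u ≡ c v → ¬ Adj G u v
    same-class cu≡cv uv = proper uv cu≡cv

    partner-class : ∀ v → c (partner v) ≡ c v
    partner-class v with classmate? v
    ... | yes (_ , _ , cw) = cw
    ... | no _             = refl

    -- A second classmate of `v` would complete a stable triple, so the outcome of the search in
    -- `partner` does not depend on its order.
    partner-unique : ∀ {u v} → u ≢ v → c u ≡ c v → partner v ≡ u
    partner-unique {u} {v} u≢v cu with classmate? v
    ... | no none = ⊥-elim (none (u , u≢v , cu))
    ... | yes (w , w≢v , cw) = decidable-stable (w ≟ u) λ w≢u →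
      no-stable-triple w≢u w≢v u≢v (same-class (trans cw (sym cu))) (same-class cw) (same-class cu)

    partner-involutive : Involutive partner
    partner-involutive v with partner v ≟ v
    ... | yes pv≡v = trans (cong partner pv≡v) pv≡v
    ... | no pv≢v  = partner-unique (pv≢v ∘ sym) (sym (partner-class v))

    classes : Matching G
    classes = record
      { mate = partner
      ; involutive = partner-involutive
      ; nonadj = λ v → same-class (sym (partner-class v))
      }

    singleton : ∀ {v w} → partner v ≡ v → c w ≡ c v → w ≡ v
    singleton {v} {w} pv≡v cw = decidable-stable (w ≟ v) λ w≢v →
      w≢v (trans (sym (partner-unique w≢v cw)) pv≡v)

    class-reps : Fin t → Fin n → Bool
    class-reps i v = (i == c v) ∧ reps partner v

    class-reps-unique : ∀ i {u v} → class-reps i u ≡ true → class-reps i v ≡ true → u ≡ v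
    class-reps-unique i {u} {v} u∈ v∈ with i ≟ c u | i ≟ c v
    ... | yes refl | yes cu≡cv = decidable-stable (u ≟ v) λ u≢v → u≢v (toℕ-injective (ℕₚ.≤-antisym
      (subst (λ w → toℕ u ≤ toℕ w) (partner-unique (u≢v ∘ sym) (sym cu≡cv)) (does⇒ (toℕ u ≤? toℕ (partner u)) u∈))
      (subst (λ w → toℕ v ≤ toℕ w) (partner-unique u≢v cu≡cv) (does⇒ (toℕ v ≤? toℕ (partner v)) v∈))))

    count-class-reps : count (reps partner) ≡ sum (λ i → count (class-reps i))
    count-class-reps = trans (sum-cong-≗ pointwise) (∑-comm (λ v i → 𝟙 (class-reps i v)))
      where
      pointwise : ∀ v → 𝟙 (reps partner v) ≡ sum (λ i → 𝟙 ((i == c v) ∧ reps partner v))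
      pointwise v with reps partner v
      ... | true  = sym (trans (count-cong λ i → ∧-identityʳ (i == c v)) (count-== (c v)))
      ... | false = sym (count-none (λ i → (i == c v) ∧ false) λ i → ∧-zeroʳ (i == c v))

    reps≤colors : count (reps partner) ≤ t
    reps≤colors = begin
      count (reps partner)               ≡⟨ count-class-reps ⟩
      sum (λ i → count (class-reps i))   ≤⟨ sum-mono-≤ (λ i → count-unique (class-reps i) (class-reps-unique i)) ⟩
      sum {t} (λ _ → 1)                  ≡⟨ count-all t ⟩
      t                                  ∎
      where open ≤-Reasoning

    reps≡colors : (∀ i → ∃[ v ] c v ≡ i) → count (reps partner) ≡ t
    reps≡colors onto = ℕₚ.≤-antisym reps≤colors (begin
      t                                  ≡⟨ sym (count-all t) ⟩
      sum {t} (λ _ → 1)                  ≤⟨ sum-mono-≤ (λ i → nonempty i (onto i)) ⟩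
      sum (λ i → count (class-reps i))   ≡⟨ sym count-class-reps ⟩
      count (reps partner)               ∎)
      where
      open ≤-Reasoning
      at-least-one : ∀ i v → class-reps i v ≡ true → 1 ≤ count (class-reps i)
      at-least-one i v v∈ = unique⇒length≤count (class-reps i) ([] ∷ []) (v∈ ∷ [])
      nonempty : ∀ i → ∃[ v ] c v ≡ i → 1 ≤ count (class-reps i)
      nonempty i (v , refl) with ℕₚ.≤-total (toℕ v) (toℕ (partner v))
      ... | inj₁ v≤pv = at-least-one i v
        (cong₂ _∧_ (dec-true (i ≟ c v) refl) (dec-true (toℕ v ≤? toℕ (partner v)) v≤pv))
      ... | inj₂ pv≤v = at-least-one i (partner v)
        (cong₂ _∧_ (dec-true (i ≟ c (partner v)) (sym (partner-class v)))
                   (dec-true (toℕ (partner v) ≤? toℕ (partner (partner v)))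
                     (subst (λ w → toℕ (partner v) ≤ toℕ w) (sym (partner-involutive v)) pv≤v)))

    -- The b-vertex of the class of `x` is `x` or its partner. As `a` and `b` are singleton classes,
    -- a neighbor in their class is `a` or `b` itself, so the first case generally gives the edge
    -- from `a` to `x` and the second the edge from `b` to `partner x`.
    b-coloring⇒stuck : (∀ i → ∃[ v ] c v ≡ i × IsBVertex G c v) → Stuck G partner
    b-coloring⇒stuck b-vertices a b x a≢b fa fb with b-vertices (c x)
    ... | v , cv , b-vertex with v ≟ x
    ...   | yes refl = case-x (c a ≟ c x)
      where
      case-x : Dec (c a ≡ c x) → Adj G a x ⊎ Adj G b (partner x)
      case-x (no ca≢cx) with b-vertex (c a) ca≢cx
      ... | w , xw , cw = inj₁ (symm G (subst (Adj G x) (singleton fa cw) xw))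
      -- Here `a` is `x` and its own partner, so its edge to the class of `b` gives the second
      -- alternative.
      case-x (yes ca≡cx) with singleton fa (sym ca≡cx)
      ... | refl with b-vertex (c b) (λ cb≡ca → a≢b (sym (singleton fa cb≡ca)))
      ...   | w , aw , cw = inj₂ (subst (Adj G b) (sym fa) (symm G (subst (Adj G a) (singleton fb cw) aw)))
    ...   | no v≢x with partner-unique v≢x cv
    ...     | refl = case-fx (c b ≟ c x)
      where
      case-fx : Dec (c b ≡ c x) → Adj G a x ⊎ Adj G b (partner x)
      case-fx (no cb≢cx) with b-vertex (c b) (λ cb → cb≢cx (trans cb cv))
      ... | w , vw , cw = inj₂ (symm G (subst (Adj G (partner x)) (singleton fb cw) vw))
      case-fx (yes cb≡cx) with singleton fb (sym cb≡cx)
      ... | refl = ⊥-elim (v≢x fb)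

  -- From stuck matchings to b-colorings

  module _ (m : Matching G) (stuck : Stuck G (mate m)) where

    private
      f = mate m

    rep : Fin n → Fin n
    rep v = if reps f v then v else f v

    rep-cases : ∀ v → rep v ≡ v ⊎ rep v ≡ f v
    rep-cases v with reps f v
    ... | true  = inj₁ refl
    ... | false = inj₂ refl

    rep-in : ∀ v → reps f (rep v) ≡ true
    rep-in v with reps f v in eq
    ... | true  = eq
    ... | false = dec-true (toℕ (f v) ≤? toℕ (f (f v)))
      (subst (λ w → toℕ (f v) ≤ toℕ w) (sym (involutive m v))
        (ℕₚ.<⇒≤ (ℕₚ.≰⇒> (does⇒¬ (toℕ v ≤? toℕ (f v)) eq))))

    reps-antisym : ∀ v → reps f v ≡ true → reps f (f v) ≡ true → f v ≡ v
    reps-antisym v v∈ fv∈ = toℕ-injective (ℕₚ.≤-antisym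
      (subst (λ w → toℕ (f v) ≤ toℕ w) (involutive m v) (does⇒ (toℕ (f v) ≤? toℕ (f (f v))) fv∈))
      (does⇒ (toℕ v ≤? toℕ (f v)) v∈))

    rep-rep : ∀ v → reps f v ≡ true → rep v ≡ v
    rep-rep v v∈ rewrite v∈ = refl

    rep-mate : ∀ v → rep (f v) ≡ rep v
    rep-mate v with reps f v in v? | reps f (f v) in fv?
    ... | true  | true  = reps-antisym v v? fv?
    ... | true  | false = involutive m v
    ... | false | true  = refl
    ... | false | false = ⊥-elim (true≢false (subst (λ w → reps f w ≡ true) (rep-out v?) (rep-in v)) fv?)
      where
      rep-out : ∀ {v} → reps f v ≡ false → rep v ≡ f v
      rep-out v∉ rewrite v∉ = refl

    same-rep : ∀ u v → rep u ≡ rep v → u ≡ v ⊎ u ≡ f v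
    same-rep u v eq with rep-cases u | rep-cases v
    ... | inj₁ ru | inj₁ rv = inj₁ (trans (sym ru) (trans eq rv))
    ... | inj₁ ru | inj₂ rv = inj₂ (trans (sym ru) (trans eq rv))
    ... | inj₂ ru | inj₁ rv = inj₂ (trans (sym (involutive m u)) (cong f (trans (sym ru) (trans eq rv))))
    ... | inj₂ ru | inj₂ rv = inj₁ (trans (sym (involutive m u))
      (trans (cong f (trans (sym ru) (trans eq rv))) (involutive m v)))

    module _ {k : ℕ} (e : Fin k → Fin n) (e-in : ∀ i → reps f (e i) ≡ true)
             (e-onto : ∀ v → reps f v ≡ true → ∃[ i ] e i ≡ v) (e-injective : Injective _≡_ _≡_ e) where

      color : Fin n → Fin k
      color v = proj₁ (e-onto (rep v) (rep-in v))

      e-color : ∀ v → e (color v) ≡ rep v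
      e-color v = proj₂ (e-onto (rep v) (rep-in v))

      color-proper : IsProper G color
      color-proper {u} {v} uv cu≡cv with same-rep u v (trans (sym (e-color u)) (trans (cong e cu≡cv) (e-color v)))
      ... | inj₁ refl = irrefl G refl uv
      ... | inj₂ refl = nonadj m v (symm G uv)

      rep⇒color : ∀ v {i} → rep v ≡ e i → color v ≡ i
      rep⇒color v eq = e-injective (trans (e-color v) eq)

      -- A vertex misses no two-element class other than its own, since the
      -- complement has no triangle; only the singleton classes matter.
      b-vertex : ∀ {v} → (∀ w → f w ≡ w → w ≢ v → Adj G v w) → IsBVertex G color v
      b-vertex {v} singles j j≢ = found (f w ≟ w)
        where
        w = e j
        cw : color w ≡ j
        cw = rep⇒color w (rep-rep w (e-in j))
        cfw : color (f w) ≡ j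
        cfw = rep⇒color (f w) (trans (rep-mate w) (rep-rep w (e-in j)))
        w≢v : w ≢ v
        w≢v w≡v = j≢ (trans (sym cw) (cong color w≡v))
        fw≢v : f w ≢ v
        fw≢v fw≡v = j≢ (trans (sym cfw) (cong color fw≡v))
        found : Dec (f w ≡ w) → ∃[ u ] Adj G v u × color u ≡ j
        found (yes fw≡w) = w , singles w fw≡w w≢v , cw
        found (no fw≢w) with adj? G v w | adj? G v (f w)
        ... | yes vw | _       = w , vw , cw
        ... | no _   | yes vfw = f w , vfw , cfw
        ... | no ¬vw | no ¬vfw =
          ⊥-elim (no-stable-triple (w≢v ∘ sym) (fw≢v ∘ sym) (fw≢w ∘ sym) ¬vw ¬vfw (nonadj m w))

      -- If `x` misses an unmatched vertex `b`, then `f x` is a b-vertex in its place: stuckness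
      -- joins it to every other unmatched vertex, and the absence of stable triples joins it to `b`
      -- when `x` is matched.
      stuck⇒b-coloring : IsBColoring G color
      stuck⇒b-coloring = color-proper , b-vertices
        where
        b-vertices : ∀ i → ∃[ v ] color v ≡ i × IsBVertex G color v
        b-vertices i with any? (λ b → f b ≟ b ×-dec ¬? (b ≟ e i) ×-dec ¬? (adj? G (e i) b))
        ... | no none = e i , rep⇒color (e i) (rep-rep (e i) (e-in i)) , b-vertex λ w fw w≢x →
          decidable-stable (adj? G (e i) w) λ ¬xw → none (w , fw , w≢x , ¬xw)
        ... | yes (b , fb , b≢x , ¬xb) =
          f x , rep⇒color (f x) (trans (rep-mate x) (rep-rep x (e-in i))) , b-vertex singles
          where
          x = e i
          singles : ∀ a → f a ≡ a → a ≢ f x → Adj G (f x) a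
          singles a fa a≢fx with a ≟ b
          ... | no a≢b with stuck b a x (a≢b ∘ sym) fb fa
          ...   | inj₁ bx  = ⊥-elim (¬xb (symm G bx))
          ...   | inj₂ afx = symm G afx
          singles a fa a≢fx | yes refl with f x ≟ x
          -- Two nonadjacent unmatched vertices would be an augmenting path of length one.
          ...   | yes fx≡x with stuck a x x b≢x fa fx≡x
          ...     | inj₁ ax = ⊥-elim (¬xb (symm G ax))
          ...     | inj₂ xx = ⊥-elim (nonadj m x xx)
          singles a fa a≢fx | yes refl | no fx≢x = decidable-stable (adj? G (f x) a) λ ¬fxa →
            no-stable-triple (fx≢x ∘ sym) (b≢x ∘ sym) (a≢fx ∘ sym) (nonadj m x) ¬xb ¬fxa

    stuck⇒b-colorable : BColorable G (count (reps f))
    stuck⇒b-colorable with enumerate (reps f)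
    ... | e , e-in , e-onto , e-injective =
      color e e-in e-onto e-injective , stuck⇒b-coloring e e-in e-onto e-injective

  -- The coloring with `s` colors only has to supply a matching with fewer unmatched vertices,
  -- however many fewer; `smaller` replaces it by a stuck matching with exactly two fewer.
  step : ∀ {s} → BColorable G (suc s) → Colorable G s → BColorable G s
  step {s} (c , c-proper , b-vertices) (c′ , c′-proper) =
    finish (smaller G m (b-coloring⇒stuck c c-proper b-vertices) m′ fewer)
    where
    m  = classes c c-proper
    m′ = classes c′ c′-proper
    all-used : count (reps (mate m)) ≡ suc s
    all-used = reps≡colors c c-proper (λ i → proj₁ (b-vertices i) , proj₁ (proj₂ (b-vertices i)))
    fewer : unmatched G m′ < unmatched G m
    fewer = ℕₚ.+-cancelˡ-< n _ _ (begin-strict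
      n + unmatched G m′                                   ≡⟨ sym (count-reps (involutive m′)) ⟩
      count (reps (mate m′)) + count (reps (mate m′))      ≤⟨ ℕₚ.+-mono-≤ (reps≤colors c′ c′-proper) (reps≤colors c′ c′-proper) ⟩
      s + s                                                <⟨ ℕₚ.+-mono-< (ℕₚ.n<1+n s) (ℕₚ.n<1+n s) ⟩
      suc s + suc s                                        ≡⟨ sym (cong₂ _+_ all-used all-used) ⟩
      count (reps (mate m)) + count (reps (mate m))        ≡⟨ count-reps (involutive m) ⟩
      n + unmatched G m                                    ∎)
      where open ≤-Reasoning
    colors : ∀ h → unmatched G m ≡ 2 + unmatched G h → count (reps (mate h)) ≡ s
    colors h size = ℕₚ.suc-injective (double-injective (begin
      suc k + suc k                                      ≡⟨ cong suc (ℕₚ.+-suc k k) ⟩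
      2 + (k + k)                                        ≡⟨ cong (2 +_) (count-reps (involutive h)) ⟩
      2 + (n + unmatched G h)                            ≡⟨ shift n _ ⟩
      n + (2 + unmatched G h)                            ≡⟨ cong (n +_) (sym size) ⟩
      n + unmatched G m                                  ≡⟨ sym (count-reps (involutive m)) ⟩
      count (reps (mate m)) + count (reps (mate m))      ≡⟨ cong₂ _+_ all-used all-used ⟩
      suc s + suc s                                      ∎))
      where
      open ≡-Reasoning
      k = count (reps (mate h))
      double-injective : ∀ {a b} → a + a ≡ b + b → a ≡ b
      double-injective {a} {b} eq = ℕₚ.*-cancelˡ-≡ a b 2
        (trans (cong (a +_) (ℕₚ.+-identityʳ a)) (trans eq (cong (b +_) (sym (ℕₚ.+-identityʳ b)))))
      shift : ∀ a b → 2 + (a + b) ≡ a + (2 + b)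
      shift = solve-∀
    finish : ∃[ h ] Stuck G (mate h) × unmatched G m ≡ 2 + unmatched G h → BColorable G s
    finish (h , stuck , size) = subst (BColorable G) (colors h size) (stuck⇒b-colorable h stuck)

colorable-mono : ∀ {G : Graph n} {s t} → s ≤ t → Colorable G s → Colorable G t
colorable-mono s≤t (c , proper) =
  (λ v → inject≤ (c v) s≤t) , λ uv eq → proper uv (inject≤-injective s≤t s≤t _ _ eq)

theorem4 : ∀ (n : ℕ) (G : Graph n) (α : ℕ) → IsStability G α → α ≤ 2 → BContinuous G
theorem4 n G α stability α≤2 χ χb (colorable , _) (b-colorable , _) t χ≤t t≤χb =
  down _ (subst (BColorable G) (sym (ℕₚ.m∸n+n≡m t≤χb)) b-colorable)
  where
  down : ∀ d → BColorable G (d + t) → BColorable G t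
  down zero    b = b
  down (suc d) b = down d (step G stability α≤2 b
    (colorable-mono {G = G} (ℕₚ.≤-trans χ≤t (ℕₚ.m≤n+m t d)) colorable))
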